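{- For every automata network $F:\Sigma^n\to\Sigma^n$ and every block-sequential update schedule $\Delta$ over $S=\{1,\dots,n\}$, the (non-deterministic) reduction algorithm described in the context, applied to $(F,\Delta)$, returns an automata network $F'$, defined over a subset of $S$, such that the limit dynamics of $F_\Delta$ and of $F'_\pi$ are isomorphic (as digraphs), where $\pi$ is the parallel update schedule.
   Context: Let $\Sigma$ be a finite alphabet. An automata network (AN) over a finite set $S$ of automata is a function $F:\Sigma^S\to\Sigma^S$ (written $\Sigma^n\to\Sigma^n$ when $S=\{1,\dots,n\}$); its local functions are $f_i(x)=F(x)_i$, $i\in S$. Automaton $i$ influences $j$ if there are configurations $x,x'$ that differ exactly at $i$ with $f_j(x)\neq f_j(x')$. The interaction digraph $G_I(F)$ has node set $S$ and an edge $(i,j)$ if and only if $i$ influences $j$. For $X\subseteq S$, $F_X(x)_i=f_i(x)$ if $i\in X$ and $F_X(x)_i=x_i$ otherwise. A block-sequential update schedule $\Delta=(X_0,\dots,X_p)$ is a finite sequence of non-empty subsets (blocks) of $S$ that form a partition of $S$, and $F_\Delta=F_{X_p}\circ\cdots\circ F_{X_0}$. The parallel update schedule $\pi$ consists of the single block of all automata, so $F_\pi=F$. The dynamics of $F_\Delta$ is the digraph on all configurations with an edge $(x,y)$ if and only if $F_\Delta(x)=y$. A limit cycle of length $k$ is a sequence of distinct configurations $(x_1,\dots,x_k)$ with $F_\Delta(x_i)=x_{i+1}$ for $1\le i<k$ and $F_\Delta(x_k)=x_1$; a fixed point is a limit cycle of length one. The limit dynamics of $F_\Delta$ is the subgraph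 of the dynamics containing only the limit cycles and fixed points. We say that $u$ precedes $v$ in $\Delta$ if the block containing $u$ occurs strictly before the block containing $v$. Parallelization algorithm (input: local functions $(f_s)_{s\in S}$ of $F$, and $\Delta$): (P1) For every pair $(u,v)$ such that $u$ precedes $v$ in $\Delta$, apply the substitution $x_u\mapsto\theta_u$ in $f_v$, where $\theta_u$ is a temporary symbol. (P2) Let $X\gets S$. While $|X|>0$: choose $s\in X$ such that $f_s$ contains no $\theta$ symbol; set $X\gets X\setminus\{s\}$; for every $s'\in X$ such that $f_{s'}$ contains $\theta_s$, apply the substitution $\theta_s\mapsto f_s$ in $f_{s'}$ (with the current $f_s$). (P3) Return the resulting network on $S$. Reduction algorithm (input: $F$ over $S$ and $\Delta$): (R1) Let $F'$ be the result of the parallelization algorithm on $(F,\Delta)$; below, $f_u$ denotes the current local functions of $F'$, and $G_I(F')$ its interaction digraph. (R2) For each $(u,v)\in S^2$ (in any order, chosen non-deterministically): if $f_u(x)=g(f_v(x))$ for all $x$, for some $g:\Sigma\to\Sigma$, then for every $w$ with $(u,w)$ an edge of $G_I(F')$, apply the substitution $x_u\mapsto g(x_v)$ in $f_w$. (R3) While there is an automaton $u\in S$ with no out-neighbour in the current interaction digraph of the network, set $S\gets S\setminus\{u\}$, i.e. remove $u$ from the network. (R4) Return the resulting network $F'$ on the remaining set of automata. -}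

module Defs where

open import Data.Bool.Base using (if_then_else_)
open import Data.Fin.Base as Fin using (Fin; inject₁; fromℕ)
import Data.Fin.Properties as Fin
open import Data.Fin.Subset using (Subset; inside; outside; _∈_; _⊆_; _∩_; _-_; ⊤; ⋃; ⁅_⁆; Nonempty; Empty)
open import Data.Fin.Subset.Properties using (_∈?_; ∈⊤; p─q⊆p)
open import Data.List.Base as List using (List; []; _∷_; allFin; cartesianProduct)
open import Data.List.Relation.Binary.Permutation.Propositional using (_↭_)
open import Data.List.Relation.Unary.All using (All)
open import Data.List.Relation.Unary.AllPairs using (AllPairs)
open import Data.Nat.Base using (ℕ; zero; suc; NonZero)
open import Data.Product.Base using (Σ; ∃; ∃₂; _×_; _,_; proj₁; proj₂)
open import Data.Vec.Base as Vec using (Vec; []; _∷_; here; there)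
open import Data.Vec.Relation.Unary.Any using (Any)
open import Function.Base using (_∘_)
open import Function.Bundles using (Inverse; _⇔_)
open import Function.Definitions using (Injective)
open import Level using (0ℓ)
open import Relation.Binary.Bundles using (Setoid)
open import Relation.Binary.Core using (Rel)
import Relation.Binary.Construct.On as On
open import Relation.Binary.PropositionalEquality using (_≡_; _≢_; refl; cong; cong₂; setoid)
open import Relation.Nullary using (¬_; Dec; does)
open import Relation.Nullary.Decidable using (_×-dec_)
open import Relation.Unary using (Pred)

-- Vertices form a setoid so that a subgraph, whose vertices carry a proof
-- of membership, does not have one vertex for each such proof.
record Digraph : Set₁ where
  field
    vertices : Setoid 0ℓ 0ℓ
  Vertex : Set
  Vertex = Setoid.Carrier vertices
  field
    Edge : Rel Vertex 0ℓ

open Digraph public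

record _≅_ (G H : Digraph) : Set where
  field
    bijection : Inverse (vertices G) (vertices H)
    edges     : ∀ x y → Edge G x y ⇔ Edge H (Inverse.to bijection x) (Inverse.to bijection y)

induced : (G : Digraph) → Pred (Vertex G) 0ℓ → Digraph
induced G P = record
  { vertices = On.setoid {B = ∃ P} (vertices G) proj₁
  ; Edge     = λ x y → Edge G (proj₁ x) (proj₁ y)
  }

-- The alphabet is Fin q throughout, and automata are taken from Fin n.
--
-- Σ^S for S ⊆ {1,…,n}: a letter for each element of S and nothing else, so
-- that _≡_ is equality of configurations.
data Config (q : ℕ) : {n : ℕ} → Subset n → Set where
  []   : Config q []
  _∷_  : ∀ {n} {S : Subset n} → Fin q → Config q S → Config q (inside ∷ S)
  skip : ∀ {n} {S : Subset n} → Config q S → Config q (outside ∷ S)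

Node : ∀ {n} → Subset n → Set
Node S = ∃ λ i → i ∈ S

node : ∀ {n} → Fin n → Node (⊤ {n})
node i = i , ∈⊤

infixl 9 _!_

_!_ : ∀ {q n} {S : Subset n} → Config q S → Node S → Fin q
(a ∷ x) ! (_ , here)        = a
(a ∷ x) ! (_ , there i∈S)   = x ! (_ , i∈S)
(skip x) ! (_ , there i∈S)  = x ! (_ , i∈S)

tabulate : ∀ {q n} {S : Subset n} → (Node S → Fin q) → Config q S
tabulate {S = []}          h = []
tabulate {S = inside ∷ S}  h = h (_ , here) ∷ tabulate λ (i , i∈S) → h (Fin.suc i , there i∈S)
tabulate {S = outside ∷ S} h = skip (tabulate λ (i , i∈S) → h (Fin.suc i , there i∈S))

infixl 8 _[_]≔_

_[_]≔_ : ∀ {q n} {S : Subset n} → Config q S → Node S → Fin q → Config q S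
x [ i ]≔ a = tabulate λ j → if does (proj₁ j Fin.≟ proj₁ i) then a else x ! j

restrict : ∀ {q n} {S T : Subset n} → T ⊆ S → Config q S → Config q T
restrict T⊆S x = tabulate λ (i , i∈T) → x ! (i , T⊆S i∈T)

AN : (q : ℕ) {n : ℕ} → Subset n → Set
AN q S = Config q S → Config q S

DifferExactlyAt : ∀ {q n} {S : Subset n} → Node S → Rel (Config q S) 0ℓ
DifferExactlyAt i x x′ = x ! i ≢ x′ ! i × (∀ j → proj₁ j ≢ proj₁ i → x ! j ≡ x′ ! j)

Influences : ∀ {q n} {S : Subset n} → AN q S → Node S → Node S → Set
Influences F i j = ∃₂ λ x x′ → DifferExactlyAt i x x′ × F x ! j ≢ F x′ ! j

interactionDigraph : ∀ {q n} {S : Subset n} → AN q S → Digraph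
interactionDigraph {n = n} {S} F = record
  { vertices = On.setoid {B = Node S} (setoid (Fin n)) proj₁
  ; Edge     = Influences F
  }

updateBlock : ∀ {q n} {S : Subset n} → AN q S → Subset n → AN q S
updateBlock F X x = tabulate λ i → if does (proj₁ i ∈? X) then F x ! i else x ! i

Schedule : ℕ → Set
Schedule n = List (Subset n)

record BlockSequential {n} (S : Subset n) (Δ : Schedule n) : Set where
  field
    nonempty : All Nonempty Δ
    disjoint : AllPairs (λ X Y → Empty (X ∩ Y)) Δ
    covering : ⋃ Δ ≡ S

π : ∀ {n} → Subset n → Schedule n
π S = S ∷ []

infix 9 _⟨_⟩

_⟨_⟩ : ∀ {q n} {S : Subset n} → AN q S → Schedule n → AN q S
(F ⟨ [] ⟩) x    = x
(F ⟨ X ∷ Δ ⟩) x = (F ⟨ Δ ⟩) (updateBlock F X x)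

Precedes : ∀ {n} → Schedule n → Rel (Fin n) 0ℓ
Precedes Δ u v = ∃₂ λ i j → i Fin.< j × u ∈ List.lookup Δ i × v ∈ List.lookup Δ j

precedes? : ∀ {n} (Δ : Schedule n) (u v : Fin n) → Dec (Precedes Δ u v)
precedes? Δ u v = Fin.any? λ i → Fin.any? λ j →
  (i Fin.<? j) ×-dec (u ∈? List.lookup Δ i) ×-dec (v ∈? List.lookup Δ j)

dynamics : ∀ {C : Set} → (C → C) → Digraph
dynamics {C} G = record { vertices = setoid C ; Edge = λ x y → G x ≡ y }

record LimitCycle {C : Set} (G : C → C) : Set where
  field
    length-1 : ℕ
    at       : Fin (suc length-1) → C
    distinct : Injective _≡_ _≡_ at
    step     : ∀ i → G (at (inject₁ i)) ≡ at (Fin.suc i)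
    closes   : G (at (fromℕ length-1)) ≡ at Fin.zero

OnLimitCycle : ∀ {C : Set} → (C → C) → Pred C 0ℓ
OnLimitCycle G x = Σ (LimitCycle G) λ c → ∃ λ i → LimitCycle.at c i ≡ x

limitDynamics : ∀ {C : Set} → (C → C) → Digraph
limitDynamics G = induced (dynamics G) (OnLimitCycle G)

-- The parallelization algorithm acts on local functions
-- symbolically ("contains", "substitution"), so they are given by formulas
-- built from arbitrary finitary operations on the alphabet.
data Formula (q : ℕ) (V : Set) : Set where
  var : V → Formula q V
  op  : ∀ {k} → (Vec (Fin q) k → Fin q) → Vec (Formula q V) k → Formula q V

module _ {q : ℕ} where

  mutual
    eval : ∀ {V} → (V → Fin q) → Formula q V → Fin q
    eval ρ (var a)   = ρ a
    eval ρ (op h ts) = h (evals ρ ts)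

    evals : ∀ {V k} → (V → Fin q) → Vec (Formula q V) k → Vec (Fin q) k
    evals ρ []       = []
    evals ρ (t ∷ ts) = eval ρ t ∷ evals ρ ts

  mutual
    subst : ∀ {V W} → (V → Formula q W) → Formula q V → Formula q W
    subst σ (var a)   = σ a
    subst σ (op h ts) = op h (substs σ ts)

    substs : ∀ {V W k} → (V → Formula q W) → Vec (Formula q V) k → Vec (Formula q W) k
    substs σ []       = []
    substs σ (t ∷ ts) = subst σ t ∷ substs σ ts

  data _occursIn_ {V : Set} (a : V) : Formula q V → Set where
    in-var : a occursIn var a
    in-op  : ∀ {k} {h : Vec (Fin q) k → Fin q} {ts} → Any (a occursIn_) ts → a occursIn op h ts

  Represents : ∀ {n} → (Fin n → Formula q (Fin n)) → AN q (⊤ {n}) → Set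
  Represents f F = ∀ x s → eval (λ i → x ! node i) (f s) ≡ F x ! node s

-- Every network has a presentation by formulas.
module _ {q : ℕ} where

  fromVec : ∀ {n} → Vec (Fin q) n → Config q (⊤ {n})
  fromVec []       = []
  fromVec (a ∷ as) = a ∷ fromVec as

  representation : ∀ {n} → AN q (⊤ {n}) → Fin n → Formula q (Fin n)
  representation F s = op (λ as → F (fromVec as) ! node s) (Vec.tabulate var)

  private
    fromVec-evals : ∀ {n V} (ρ : V → Fin q) (v : Fin n → V) (x : Config q (⊤ {n})) →
                    (∀ i → ρ (v i) ≡ x ! node i) → fromVec (evals ρ (Vec.tabulate (var ∘ v))) ≡ x
    fromVec-evals {zero}  ρ v []      eq = refl
    fromVec-evals {suc n} ρ v (a ∷ x) eq =
      cong₂ _∷_ (eq Fin.zero) (fromVec-evals ρ (v ∘ Fin.suc) x (eq ∘ Fin.suc))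

  representation-correct : ∀ {n} (F : AN q (⊤ {n})) → Represents (representation F) F
  representation-correct F x s =
    cong (λ y → F y ! node s) (fromVec-evals (λ i → x ! node i) (λ i → i) x λ _ → refl)

data Symbol (n : ℕ) : Set where
  𝐱 θ : Fin n → Symbol n

Formulas : ℕ → ℕ → Set
Formulas q n = Fin n → Formula q (Symbol n)

delay : ∀ {q n} → Schedule n → (Fin n → Formula q (Fin n)) → Formulas q n
delay Δ f v = subst (λ u → var (if does (precedes? Δ u v) then θ u else 𝐱 u)) (f v)

[θ_↦_] : ∀ {q n} → Fin n → Formula q (Symbol n) → Symbol n → Formula q (Symbol n)
[θ s ↦ t ] (𝐱 u) = var (𝐱 u)
[θ s ↦ t ] (θ u) = if does (u Fin.≟ s) then t else var (θ u)

-- The substitution leaves a formula not containing θ_s as it is, so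
-- whether f_{s'} contains θ_s need not be tested.
resolve : ∀ {q n} → Fin n → Subset n → Formulas q n → Formulas q n
resolve s X f s′ = if does (s′ ∈? X) then subst [θ s ↦ f s ] (f s′) else f s′

-- The formulas define F, whatever the values of any remaining θ symbols.
Defines : ∀ {q n} → Formulas q n → AN q (⊤ {n}) → Set
Defines {q} {n} f F = ∀ y (t : Fin n → Fin q) s → eval (env y t) (f s) ≡ F y ! node s
  where
  env : Config q (⊤ {n}) → (Fin n → Fin q) → Symbol n → Fin q
  env y t (𝐱 i) = y ! node i
  env y t (θ i) = t i

Factors : ∀ {q n} {S : Subset n} → AN q S → (u v : Node S) → (Fin q → Fin q) → Set
Factors F u v g = ∀ y → F y ! u ≡ g (F y ! v)

record Merge {q n} {S : Subset n} (F : AN q S) (u v : Node S) (g : Fin q → Fin q) (F′ : AN q S) : Set where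
  field
    substituted : ∀ w → Edge (interactionDigraph F) u w → ∀ y → F′ y ! w ≡ F (y [ u ]≔ g (y ! v)) ! w
    unchanged   : ∀ w → ¬ Edge (interactionDigraph F) u w → ∀ y → F′ y ! w ≡ F y ! w

Sink : ∀ {q n} {S : Subset n} → AN q S → Node S → Set
Sink F u = ∀ w → ¬ Edge (interactionDigraph F) u w

-- F′ is F without u, provided that u is a sink of F.
Removal : ∀ {q n} {S : Subset n} (u : Fin n) → AN q S → AN q (S - u) → Set
Removal {S = S} u F F′ = ∀ y → F′ (forget y) ≡ forget (F y)
  where
  forget : Config _ S → Config _ (S - u)
  forget = restrict (p─q⊆p S ⁅ u ⁆)

data State (q n : ℕ) : Set where
  parallelizing : Subset n → Formulas q n → State q n
  merging       : List (Fin n × Fin n) → AN q (⊤ {n}) → State q n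
  pruning       : (S : Subset n) → AN q S → State q n
  returned      : (S : Subset n) → AN q S → State q n

start : ∀ {q n} → Schedule n → (Fin n → Formula q (Fin n)) → State q n
start Δ f = parallelizing ⊤ (delay Δ f)

infix 4 _⟶_

data _⟶_ {q n : ℕ} : State q n → State q n → Set where
  resolving   : ∀ {X f s} → s ∈ X → (∀ u → ¬ (θ u occursIn f s)) →
                parallelizing X f ⟶ parallelizing (X - s) (resolve s (X - s) f)
  -- ps is the non-deterministically chosen order in which the pairs are treated.
  parallel    : ∀ {X f F ps} → Empty X → Defines f F → ps ↭ cartesianProduct (allFin n) (allFin n) →
                parallelizing X f ⟶ merging ps F
  merge       : ∀ {u v ps F F′} g → Factors F (node u) (node v) g → Merge F (node u) (node v) g F′ →
                merging ((u , v) ∷ ps) F ⟶ merging ps F′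
  no-merge    : ∀ {u v ps F} → ¬ ∃ (Factors F (node u) (node v)) →
                merging ((u , v) ∷ ps) F ⟶ merging ps F
  all-treated : ∀ {F} → merging [] F ⟶ pruning ⊤ F
  remove      : ∀ {S F} (u : Node S) {F′ : AN q (S - proj₁ u)} → Sink F u → Removal (proj₁ u) F F′ →
                pruning S F ⟶ pruning (S - proj₁ u) F′
  return      : ∀ {S F} → ¬ ∃ (Sink F) → pruning S F ⟶ returned S F

data Returned {q n : ℕ} : State q n → Set where
  returned : ∀ S F → Returned (returned S F)

{-# OPTIONS --safe #-}

-- For maps h : A → B and k : B → A, the limit dynamics of k ∘ h and h ∘ k are
-- isomorphic via h, and both reduction steps replace a network k ∘ h by h ∘ k.
-- If F(x)_u = g(F(x)_v), let σ(y) be y with y_u replaced by g(y_v): then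
-- σ ∘ F = F, and the substitution yields F ∘ σ.  If u is a sink, then F factors
-- through the restriction r to S - u, as F = F ∘ e ∘ r for any section e of r,
-- and removing u yields r ∘ F ∘ e.
--
-- The parallelization computes F ⟨ Δ ⟩ itself: each substitution preserves the
-- values of the formulas when every θ_u is read as F ⟨ Δ ⟩(x)_u.  It never gets
-- stuck, since a remaining automaton whose block comes first has no θ left.
module Submission where

open import Defs
open import Data.Bool.Base using (if_then_else_)
open import Data.Fin.Base as Fin using (Fin; toℕ; inject₁)
open import Data.Fin.Induction using (<-weakInduction)
import Data.Fin.Properties as Fin
open import Data.Fin.Subset using (Subset; inside; outside; _∈_; _∉_; _-_; _─_; _∩_; ⊤; ⋃; ⁅_⁆; Empty; Nonempty; ∣_∣)
open import Data.Fin.Subset.Properties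
  using (_∈?_; ∈⊤; ∉⊥; nonempty?; x∈p∩q⁺; x∈⁅x⁆; x∈p∪q⁻; p─q⊆p; x∈p∧x≢y⇒x∈p-y; x∈p⇒∣p-x∣<∣p∣)
open import Data.List.Base using ([]; _∷_; lookup)
open import Data.List.Membership.Propositional.Properties using (∈-lookup)
open import Data.List.Relation.Binary.Permutation.Propositional using (↭-refl)
open import Data.List.Relation.Unary.All as All using (All; []; _∷_)
open import Data.List.Relation.Unary.AllPairs using (AllPairs; []; _∷_)
open import Data.Nat.Base using (ℕ; zero; suc; _+_; _*_; _<_; s<s; z<s; NonZero)
open import Data.Nat.GeneralisedArithmetic using (fold; fold-+)
open import Data.Nat.Induction using (<-wellFounded)
open import Data.Nat.Properties using (+-comm; *-comm; _<?_)
open import Data.Product.Base using (∃; _×_; _,_; proj₁; proj₂)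
open import Data.Sum.Base using (_⊎_; inj₁; inj₂)
open import Data.Vec.Base using (Vec; []; _∷_; here; there)
open import Data.Vec.Properties.WithK using ([]=-irrelevant)
open import Data.Vec.Relation.Unary.Any using (Any; here; there)
open import Function.Base using (_∘_; flip; id)
open import Function.Bundles using (mk⇔)
import Function.Construct.Composition as Composition
open import Induction.WellFounded using (Acc; acc)
open import Level using (0ℓ)
open import Relation.Binary.Construct.Closure.ReflexiveTransitive using (Star; ε; _◅_)
open import Relation.Binary.PropositionalEquality
  using (_≡_; _≢_; refl; sym; trans; cong; cong₂; module ≡-Reasoning)
import Relation.Binary.PropositionalEquality as ≡
open import Relation.Nullary using (¬_; Dec; yes; no; does; contradiction)
open import Relation.Nullary.Decidable
  using (¬?; _×-dec_; _→-dec_; decidable-stable; map′; dec-true; dec-false)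
open import Relation.Unary using (Decidable; Pred)

open ≡-Reasoning

-- Limit dynamics of k ∘ h and h ∘ k

fold-shift : ∀ {A : Set} (x : A) (G : A → A) m → fold (G x) G m ≡ G (fold x G m)
fold-shift x G m = begin
  fold (G x) G m   ≡⟨ fold-+ x G m ⟨
  fold x G (m + 1) ≡⟨ cong (fold x G) (+-comm m 1) ⟩
  G (fold x G m)   ∎

fold-period : ∀ {A : Set} {x : A} {G : A → A} m → fold x G m ≡ x → ∀ p → fold x G (p * m) ≡ x
fold-period m eq zero    = refl
fold-period {x = x} {G} m eq (suc p) = begin
  fold x G (m + p * m)          ≡⟨ fold-+ x G m ⟩
  fold (fold x G (p * m)) G m   ≡⟨ cong (λ y → fold y G m) (fold-period m eq p) ⟩
  fold x G m                    ≡⟨ eq ⟩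
  x                             ∎

module _ {A : Set} {G : A → A} where

  -- `at i` is the `toℕ i`-fold iterate of `at zero`, and iteration counts commute, so the period of
  -- `at zero` is a period of every point of the cycle. The form `suc m` lets one application of `G`
  -- be split off.
  limit⇒periodic : ∀ {x} → OnLimitCycle G x → ∃ λ m → fold x G (suc m) ≡ x
  limit⇒periodic (c , i , refl) = length-1 , (begin
    fold (at i) G l              ≡⟨ cong (λ y → fold y G l) (at≡fold i) ⟩
    fold (fold x₀ G (toℕ i)) G l ≡⟨ fold-+ x₀ G l ⟨
    fold x₀ G (l + toℕ i)        ≡⟨ cong (fold x₀ G) (+-comm l (toℕ i)) ⟩
    fold x₀ G (toℕ i + l)        ≡⟨ fold-+ x₀ G (toℕ i) ⟩
    fold (fold x₀ G l) G (toℕ i) ≡⟨ cong (λ y → fold y G (toℕ i)) round ⟩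
    fold x₀ G (toℕ i)            ≡⟨ at≡fold i ⟨
    at i                         ∎)
    where
    open LimitCycle c
    l = suc length-1
    x₀ = at Fin.zero
    at≡fold : ∀ j → at j ≡ fold x₀ G (toℕ j)
    at≡fold = <-weakInduction (λ j → at j ≡ fold x₀ G (toℕ j)) refl λ j eq → begin
      at (Fin.suc j)               ≡⟨ step j ⟨
      G (at (inject₁ j))           ≡⟨ cong G eq ⟩
      G (fold x₀ G (toℕ (inject₁ j))) ≡⟨ cong (G ∘ fold x₀ G) (Fin.toℕ-inject₁ j) ⟩
      G (fold x₀ G (toℕ j))        ∎
    round : fold x₀ G l ≡ x₀
    round = begin
      G (fold x₀ G length-1)                     ≡⟨ cong (G ∘ fold x₀ G) (Fin.toℕ-fromℕ length-1) ⟨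
      G (fold x₀ G (toℕ (Fin.fromℕ length-1)))   ≡⟨ cong G (at≡fold (Fin.fromℕ length-1)) ⟨
      G (at (Fin.fromℕ length-1))                ≡⟨ closes ⟩
      x₀                                         ∎

  -- The two cycles may differ in length, so both points are run through the product of their
  -- periods. This common period recovers each point from its image under `G`.
  injective-on-limit : ∀ {x y} → OnLimitCycle G x → OnLimitCycle G y → G x ≡ G y → x ≡ y
  injective-on-limit {x} {y} cx cy eq with limit⇒periodic cx | limit⇒periodic cy
  ... | m , xᵐ | p , yᵖ = begin
    x                         ≡⟨ fold-period {G = G} (suc m) xᵐ (suc p) ⟨
    fold x G (suc p * suc m)  ≡⟨ fold-shift x G r ⟨
    fold (G x) G r            ≡⟨ cong (λ z → fold z G r) eq ⟩
    fold (G y) G r            ≡⟨ fold-shift y G r ⟩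
    fold y G (suc p * suc m)  ≡⟨ cong (fold y G) (*-comm (suc p) (suc m)) ⟩
    fold y G (suc m * suc p)  ≡⟨ fold-period {G = G} (suc p) yᵖ (suc m) ⟩
    y                         ∎
    -- `suc r` is `suc p * suc m` by the definition of `_*_`; the missing step is the one already
    -- made in `G x` and `G y`.
    where r = m + p * suc m

-- Kept as a module of its own so that it can be instantiated a second time with `h` and `k`
-- exchanged, which carries limit cycles back.
module Swap {A B : Set} {G : A → A} {H : B → B} (h : A → B) (k : B → A)
            (G≗k∘h : ∀ x → G x ≡ k (h x)) (H≗h∘k : ∀ y → H y ≡ h (k y)) where

  intertwines : ∀ x → H (h x) ≡ h (G x)
  intertwines x = trans (H≗h∘k (h x)) (cong h (sym (G≗k∘h x)))

  intertwines-fold : ∀ x m → h (fold x G m) ≡ fold (h x) H m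
  intertwines-fold x zero    = refl
  intertwines-fold x (suc m) = trans (sym (intertwines (fold x G m))) (cong H (intertwines-fold x m))

  h-injective : ∀ {x y} → OnLimitCycle G x → OnLimitCycle G y → h x ≡ h y → x ≡ y
  h-injective {x} {y} cx cy eq =
    injective-on-limit cx cy (trans (G≗k∘h x) (trans (cong k eq) (sym (G≗k∘h y))))

  h-limit : ∀ {x} → OnLimitCycle G x → OnLimitCycle H (h x)
  h-limit (c , i , refl) = record
    { length-1 = length-1
    ; at       = h ∘ at
    ; distinct = λ eq → distinct (h-injective (c , _ , refl) (c , _ , refl) eq)
    ; step     = λ j → trans (intertwines _) (cong h (step j))
    ; closes   = trans (intertwines _) (cong h closes)
    } , i , refl
    where open LimitCycle c

module _ {A B : Set} {G : A → A} {H : B → B} (h : A → B) (k : B → A)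
         (G≗k∘h : ∀ x → G x ≡ k (h x)) (H≗h∘k : ∀ y → H y ≡ h (k y)) where

  open Swap h k G≗k∘h H≗h∘k

  private
    k-limit : ∀ {y} → OnLimitCycle H y → OnLimitCycle G (k y)
    k-limit = Swap.h-limit k h H≗h∘k G≗k∘h

    G-limit : ∀ {x} → OnLimitCycle G x → OnLimitCycle G (G x)
    G-limit {x} cx = ≡.subst (OnLimitCycle G) (sym (G≗k∘h x)) (k-limit (h-limit cx))

    fold-limit : ∀ {x} → OnLimitCycle G x → ∀ m → OnLimitCycle G (fold x G m)
    fold-limit cx zero    = cx
    fold-limit cx (suc m) = G-limit (fold-limit cx m)

    -- In general `k` does not invert `h` on limit points, since `k ∘ h` is `G`, a shift along the
    -- cycle. If `y` has period `suc m`, then `m` further steps complete the turn: `h` maps the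
    -- result to `suc m` steps of `H` from `y`.
    preimage : ∀ {y} → OnLimitCycle H y → A
    preimage {y} cy = fold (k y) G (proj₁ (limit⇒periodic cy))

    preimage-limit : ∀ {y} (cy : OnLimitCycle H y) → OnLimitCycle G (preimage cy)
    preimage-limit cy = fold-limit (k-limit cy) (proj₁ (limit⇒periodic cy))

    h-preimage : ∀ {y} (cy : OnLimitCycle H y) → h (preimage cy) ≡ y
    h-preimage {y} cy with limit⇒periodic cy
    ... | m , yᵐ = begin
      h (fold (k y) G m)   ≡⟨ intertwines-fold (k y) m ⟩
      fold (h (k y)) H m   ≡⟨ cong (λ z → fold z H m) (H≗h∘k y) ⟨
      fold (H y) H m       ≡⟨ fold-shift y H m ⟩
      fold y H (suc m)     ≡⟨ yᵐ ⟩
      y                    ∎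

  limitDynamics-swap : limitDynamics G ≅ limitDynamics H
  limitDynamics-swap = record
    { bijection = record
      { to        = λ (x , cx) → h x , h-limit cx
      ; from      = λ (y , cy) → preimage cy , preimage-limit cy
      ; to-cong   = cong h
      ; from-cong = λ {(y , cy)} {(y₁ , cy₁)} eq →
          h-injective (preimage-limit cy) (preimage-limit cy₁)
            (trans (h-preimage cy) (trans eq (sym (h-preimage cy₁))))
      ; inverse   =
          (λ {(y , cy)} eq → trans (cong h eq) (h-preimage cy)) ,
          (λ {(x , cx)} {(y , cy)} eq →
            h-injective (preimage-limit cy) cx (trans (h-preimage cy) eq))
      }
    ; edges = λ (x , cx) (y , cy) → mk⇔
        (λ eq → trans (intertwines x) (cong h eq))
        (λ eq → h-injective (G-limit cx) cy (trans (sym (intertwines x)) eq))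
    }

-- The swap with `h = id` and `k = H`.
limitDynamics-cong : ∀ {A : Set} {G H : A → A} → (∀ x → G x ≡ H x) → limitDynamics G ≅ limitDynamics H
limitDynamics-cong {H = H} G≗H = limitDynamics-swap id H G≗H λ _ → refl

≅-trans : ∀ {G H K : Digraph} → G ≅ H → H ≅ K → G ≅ K
≅-trans φ ψ = record
  { bijection = Composition.inverse (_≅_.bijection φ) (_≅_.bijection ψ)
  ; edges     = λ x y → Composition.equivalence (_≅_.edges φ x y) (_≅_.edges ψ _ _)
  }

-- Configurations and exhaustive search

module _ {q : ℕ} where

  !-cong : ∀ {n} {S : Subset n} (x : Config q S) {i j : Node S} → proj₁ i ≡ proj₁ j → x ! i ≡ x ! j
  !-cong x {_ , p} {_ , p₁} refl = cong (λ i∈S → x ! (_ , i∈S)) ([]=-irrelevant p p₁)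

  tabulate-! : ∀ {n} {S : Subset n} (h : Node S → Fin q) i → tabulate h ! i ≡ h i
  tabulate-! h (_ , here)                       = refl
  tabulate-! {S = inside ∷ S}  h (_ , there p) = tabulate-! (λ (i , i∈S) → h (Fin.suc i , there i∈S)) (_ , p)
  tabulate-! {S = outside ∷ S} h (_ , there p) = tabulate-! (λ (i , i∈S) → h (Fin.suc i , there i∈S)) (_ , p)

  ext : ∀ {n} {S : Subset n} {x y : Config q S} → (∀ i → x ! i ≡ y ! i) → x ≡ y
  ext {x = []}     {[]}     eq = refl
  ext {x = a ∷ x}  {b ∷ y}  eq = cong₂ _∷_ (eq (_ , here)) (ext λ (i , p) → eq (_ , there p))
  ext {x = skip x} {skip y} eq = cong skip (ext λ (i , p) → eq (_ , there p))

-- A run must branch on whether a factorization or a sink exists, and the analysis of a merge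
-- branches on influence. All three are decided by search through finitely many nodes and
-- configurations.
Searchable : Set → Set₁
Searchable A = ∀ {P : Pred A 0ℓ} → Decidable P → Dec (∃ P)

all? : ∀ {A : Set} → Searchable A → ∀ {P : Pred A 0ℓ} → Decidable P → Dec (∀ x → P x)
all? any? P? = map′
  (λ ¬∃¬ x → decidable-stable (P? x) λ ¬Px → ¬∃¬ (x , ¬Px))
  (λ ∀P (x , ¬Px) → ¬Px (∀P x))
  (¬? (any? λ x → ¬? (P? x)))

anyConfig? : ∀ {q n} {S : Subset n} → Searchable (Config q S)
anyConfig? {S = []}          P? = map′ ([] ,_) (λ { ([] , p) → p }) (P? [])
anyConfig? {S = inside ∷ S}  P? = map′
  (λ (a , x , p) → a ∷ x , p) (λ { (a ∷ x , p) → a , x , p })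
  (Fin.any? λ a → anyConfig? λ x → P? (a ∷ x))
anyConfig? {S = outside ∷ S} P? = map′
  (λ (x , p) → skip x , p) (λ { (skip x , p) → x , p })
  (anyConfig? λ x → P? (skip x))

anyNode? : ∀ {n} {S : Subset n} → Searchable (Node S)
anyNode? {S = S} {P} P? = map′
  (λ (i , i∈S , p) → (i , i∈S) , p) (λ ((i , i∈S) , p) → i , i∈S , p)
  (Fin.any? with∈?)
  where
  with∈? : ∀ i → Dec (∃ λ i∈S → P (i , i∈S))
  with∈? i with i ∈? S
  ... | no i∉S  = no λ (i∈S , _) → i∉S i∈S
  ... | yes i∈S = map′ (i∈S ,_) (λ (i∈S₁ , p) → ≡.subst (λ m → P (i , m)) ([]=-irrelevant i∈S₁ i∈S) p) (P? (i , i∈S))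

module _ {q n : ℕ} {S : Subset n} (F : AN q S) where

  influences? : ∀ i j → Dec (Influences F i j)
  influences? i j = anyConfig? λ x → anyConfig? λ y →
    (¬? (x ! i Fin.≟ y ! i) ×-dec
     all? anyNode? λ l → ¬? (proj₁ l Fin.≟ proj₁ i) →-dec (x ! l Fin.≟ y ! l))
    ×-dec ¬? (F x ! j Fin.≟ F y ! j)

  sink? : Dec (∃ (Sink F))
  sink? = anyNode? λ u → all? anyNode? λ w → ¬? (influences? u w)

  -- `Influences` speaks of configurations that really differ at `i`. If these two agree there as
  -- well, they are equal; if not, decidable equality of letters turns the refuted inequality into
  -- an equality.
  ¬influences : ∀ {i j} → ¬ Influences F i j → ∀ {x y} →
                (∀ l → proj₁ l ≢ proj₁ i → x ! l ≡ y ! l) → F x ! j ≡ F y ! j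
  ¬influences {i} {j} ¬e {x} {y} agree with x ! i Fin.≟ y ! i
  ... | no  xᵢ≢yᵢ = decidable-stable (_ Fin.≟ _) λ Fx≢Fy → ¬e (x , y , (xᵢ≢yᵢ , agree) , Fx≢Fy)
  ... | yes xᵢ≡yᵢ = cong (λ z → F z ! j) (ext eq)
    where
    eq : ∀ l → x ! l ≡ y ! l
    eq l with proj₁ l Fin.≟ proj₁ i
    ... | no  l≢i = agree l l≢i
    ... | yes l≡i = trans (!-cong x l≡i) (trans xᵢ≡yᵢ (!-cong y (sym l≡i)))

  -- Instead of a search through all functions on the alphabet, one candidate is tested: a letter
  -- attained at `v` is sent to the value at `u` under some configuration attaining it. If any
  -- factorization exists, that value does not depend on the choice.
  factors? : ∀ u v → Dec (∃ (Factors F u v))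
  factors? u v = map′ (g ,_) uses-g (all? anyConfig? λ y → F y ! u Fin.≟ g (F y ! v))
    where
    g : Fin q → Fin q
    g a with anyConfig? (λ y → F y ! v Fin.≟ a)
    ... | yes (y , _) = F y ! u
    -- The letter `a` is never attained at `v`, so its image is arbitrary.
    ... | no  _       = a
    uses-g : ∃ (Factors F u v) → Factors F u v g
    uses-g (g₁ , factors) y with anyConfig? (λ y₁ → F y₁ ! v Fin.≟ F y ! v)
    ... | yes (y₁ , eq) = trans (factors y) (trans (cong g₁ (sym eq)) (sym (factors y₁)))
    ... | no  ¬∃        = contradiction (y , refl) ¬∃

-- Merging

module _ {q n : ℕ} {S : Subset n} where

  []≔-other : ∀ (x : Config q S) i a j → proj₁ j ≢ proj₁ i → (x [ i ]≔ a) ! j ≡ x ! j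
  []≔-other x i a j j≢i = trans (tabulate-! _ j)
    (cong (λ b → if b then a else x ! j) (dec-false (proj₁ j Fin.≟ proj₁ i) j≢i))

  []≔-unchanged : ∀ (x : Config q S) i {a} → x ! i ≡ a → x [ i ]≔ a ≡ x
  []≔-unchanged x i {a} xᵢ≡a = ext λ j → trans (tabulate-! _ j) (eq j)
    where
    eq : ∀ j → (if does (proj₁ j Fin.≟ proj₁ i) then a else x ! j) ≡ x ! j
    eq j with proj₁ j Fin.≟ proj₁ i
    ... | yes j≡i = trans (sym xᵢ≡a) (!-cong x (sym j≡i))
    ... | no  _   = refl

  redirect : Node S → Node S → (Fin q → Fin q) → Config q S → Config q S
  redirect u v g y = y [ u ]≔ g (y ! v)

  module _ {F : AN q S} {u v : Node S} {g : Fin q → Fin q} where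

    redirect-¬influences : ∀ {w} → ¬ Influences F u w → ∀ y → F (redirect u v g y) ! w ≡ F y ! w
    redirect-¬influences ¬e y = ¬influences F ¬e ([]≔-other y u (g (y ! v)))

    redirect-Merge : Merge F u v g (F ∘ redirect u v g)
    redirect-Merge = record
      { substituted = λ _ _ _ → refl
      ; unchanged   = λ _ → redirect-¬influences
      }

    -- The algorithm substitutes only along edges out of `u`. Elsewhere the substitution would have
    -- no effect, so a merge is the uniform precomposition with `redirect`.
    Merge⇒redirect : ∀ {F′} → Merge F u v g F′ → ∀ y → F′ y ≡ F (redirect u v g y)
    Merge⇒redirect {F′} merged y = ext λ w → eq w (influences? F u w)
      where
      open Merge merged
      eq : ∀ w → Dec (Influences F u w) → F′ y ! w ≡ F (redirect u v g y) ! w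
      eq w (yes e) = substituted w e y
      eq w (no ¬e) = trans (unchanged w ¬e y) (sym (redirect-¬influences ¬e y))

    Merge-limitDynamics : ∀ {F′} → Factors F u v g → Merge F u v g F′ → limitDynamics F ≅ limitDynamics F′
    Merge-limitDynamics factors merged = limitDynamics-swap F (redirect u v g)
      (λ x → sym ([]≔-unchanged (F x) u (factors x))) (Merge⇒redirect merged)

-- Removing a sink

x∈p─q⇒x∉q : ∀ {n} {x : Fin n} (p q : Subset n) → x ∈ p ─ q → x ∉ q
x∈p─q⇒x∉q (_ ∷ p)      (outside ∷ q) (there x∈p─q) (there x∈q) = x∈p─q⇒x∉q p q x∈p─q x∈q
x∈p─q⇒x∉q (_ ∷ p)      (inside ∷ q)  (there x∈p─q) (there x∈q) = x∈p─q⇒x∉q p q x∈p─q x∈q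

x∈p-y⇒x≢y : ∀ {n} {x y : Fin n} (p : Subset n) → x ∈ p - y → x ≢ y
x∈p-y⇒x≢y {x = x} p x∈p-x refl = x∈p─q⇒x∉q p ⁅ x ⁆ x∈p-x (x∈⁅x⁆ x)

module Extension {q n : ℕ} {S : Subset n} (u : Fin n) where

  forget : Config q S → Config q (S - u)
  forget = restrict (p─q⊆p S ⁅ u ⁆)

  -- The decision is an argument so that proofs can match on it; its negative case supplies the
  -- proof of membership in `S - u`.
  extendAt : Fin q → Config q (S - u) → (j : Node S) → Dec (proj₁ j ≡ u) → Fin q
  extendAt a z j (yes _)   = a
  extendAt a z j (no  j≢u) = z ! (proj₁ j , x∈p∧x≢y⇒x∈p-y (proj₂ j) j≢u)

  extend : Fin q → Config q (S - u) → Config q S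
  extend a z = tabulate λ j → extendAt a z j (proj₁ j Fin.≟ u)

  extend-! : ∀ a z i j → proj₁ j ≡ proj₁ i → proj₁ j ≢ u → extend a z ! j ≡ z ! i
  extend-! a z i j j≡i j≢u = trans (tabulate-! _ j) (extendAt-≢ (proj₁ j Fin.≟ u))
    where
    extendAt-≢ : ∀ j≟u → extendAt a z j j≟u ≡ z ! i
    extendAt-≢ (yes j≡u) = contradiction j≡u j≢u
    extendAt-≢ (no  _)   = !-cong z j≡i

  extend-forget : ∀ a y j → proj₁ j ≢ u → extend a (forget y) ! j ≡ y ! j
  extend-forget a y j j≢u = trans (extend-! a (forget y) i j refl j≢u) (trans (tabulate-! _ i) (!-cong y refl))
    where
    i : Node (S - u)
    i = _ , x∈p∧x≢y⇒x∈p-y (proj₂ j) j≢u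

  forget-extend : ∀ a z → forget (extend a z) ≡ z
  forget-extend a z = ext λ i → trans (tabulate-! _ i) (extend-! a z i _ refl (x∈p-y⇒x≢y S (proj₂ i)))

module _ {q n : ℕ} {S : Subset n} {F : AN q S} (a : Fin q) (u : Node S) (sink : Sink F u) where

  private
    module E = Extension {q} {S = S} (proj₁ u)

  -- Overwriting the value at a sink changes no output, not even the one at the sink itself, which
  -- has no loop.
  F-extend-forget : ∀ y → F y ≡ F (E.extend a (E.forget y))
  F-extend-forget y = ext λ w → ¬influences F (sink w) λ l l≢u → sym (E.extend-forget a y l l≢u)

  Removal-exists : ∃ (Removal (proj₁ u) F)
  Removal-exists = (λ z → E.forget (F (E.extend a z))) , λ y → cong E.forget (sym (F-extend-forget y))

  -- `Removal` constrains `F′` only on restrictions, but every `z` is one, namely that of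
  -- `extend a z`.
  Removal-limitDynamics : ∀ {F′} → Removal (proj₁ u) F F′ → limitDynamics F ≅ limitDynamics F′
  Removal-limitDynamics {F′} removal = limitDynamics-swap E.forget (F ∘ E.extend a) F-extend-forget λ z →
    trans (cong F′ (sym (E.forget-extend a z))) (removal (E.extend a z))

-- Block-sequential updates

module _ {q n : ℕ} {S : Subset n} (F : AN q S) where

  updateBlock-∈ : ∀ X x i → proj₁ i ∈ X → updateBlock F X x ! i ≡ F x ! i
  updateBlock-∈ X x i i∈X = trans (tabulate-! _ i)
    (cong (λ b → if b then F x ! i else x ! i) (dec-true (proj₁ i ∈? X) i∈X))

  updateBlock-∉ : ∀ X x i → proj₁ i ∉ X → updateBlock F X x ! i ≡ x ! i
  updateBlock-∉ X x i i∉X = trans (tabulate-! _ i)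
    (cong (λ b → if b then F x ! i else x ! i) (dec-false (proj₁ i ∈? X) i∉X))

  parallel-update : ∀ x → F x ≡ (F ⟨ π S ⟩) x
  parallel-update x = ext λ i → sym (updateBlock-∈ S x i (proj₂ i))

Scheduled : ∀ {n} → Schedule n → Fin n → Set
Scheduled Δ v = ∃ λ j → v ∈ lookup Δ j

Disjoint : ∀ {n} → Subset n → Subset n → Set
Disjoint X Y = Empty (X ∩ Y)

module _ {n : ℕ} where

  covered⇒scheduled : ∀ (Δ : Schedule n) {v} → v ∈ ⋃ Δ → Scheduled Δ v
  covered⇒scheduled []      v∈⊥ = contradiction v∈⊥ ∉⊥
  covered⇒scheduled (X ∷ Δ) v∈∪ with x∈p∪q⁻ X (⋃ Δ) v∈∪
  ... | inj₁ v∈X = Fin.zero , v∈X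
  ... | inj₂ v∈⋃ = let (j , v∈Y) = covered⇒scheduled Δ v∈⋃ in Fin.suc j , v∈Y

  disjoint⇒¬scheduled : ∀ {X} {Δ : Schedule n} → All (Disjoint X) Δ → ∀ {v} → v ∈ X → ¬ Scheduled Δ v
  disjoint⇒¬scheduled dis v∈X (j , v∈Y) = All.lookup dis (∈-lookup j) (_ , x∈p∩q⁺ (v∈X , v∈Y))

  precedes-∷⁻ : ∀ {X} {Δ : Schedule n} {u v} → Precedes (X ∷ Δ) u v →
                (u ∈ X × Scheduled Δ v) ⊎ Precedes Δ u v
  precedes-∷⁻ (Fin.zero  , Fin.suc j , _       , u∈X , v∈Y) = inj₁ (u∈X , j , v∈Y)
  precedes-∷⁻ (Fin.suc i , Fin.suc j , s<s i<j , u∈X , v∈Y) = inj₂ (i , j , i<j , u∈X , v∈Y)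

  precedes-head : ∀ {X} {Δ : Schedule n} {u v} → u ∈ X → Scheduled Δ v → Precedes (X ∷ Δ) u v
  precedes-head u∈X (j , v∈Y) = Fin.zero , Fin.suc j , z<s , u∈X , v∈Y

  precedes-tail : ∀ {X} {Δ : Schedule n} {u v} → Precedes Δ u v → Precedes (X ∷ Δ) u v
  precedes-tail (i , j , i<j , u∈X , v∈Y) = Fin.suc i , Fin.suc j , s<s i<j , u∈X , v∈Y

  precedes-source : ∀ (Δ : Schedule n) {u v} → Precedes Δ u v → Scheduled Δ u
  precedes-source Δ (i , _ , _ , u∈X , _) = i , u∈X

  precedes-target : ∀ (Δ : Schedule n) {u v} → Precedes Δ u v → Scheduled Δ v
  precedes-target Δ (_ , j , _ , _ , v∈Y) = j , v∈Y

  -- The index of the first block containing `v`, or the length of the schedule if there is none.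
  rank : Schedule n → Fin n → ℕ
  rank []      v = 0
  rank (X ∷ Δ) v = if does (v ∈? X) then 0 else suc (rank Δ v)

  rank-∈ : ∀ {X} {Δ : Schedule n} {v} → v ∈ X → rank (X ∷ Δ) v ≡ 0
  rank-∈ {X} {Δ} {v} v∈X = cong (if_then 0 else suc (rank Δ v)) (dec-true (v ∈? X) v∈X)

  rank-∉ : ∀ {X} {Δ : Schedule n} {v} → v ∉ X → rank (X ∷ Δ) v ≡ suc (rank Δ v)
  rank-∉ {X} {Δ} {v} v∉X = cong (if_then 0 else suc (rank Δ v)) (dec-false (v ∈? X) v∉X)

  rank-increases : ∀ {Δ : Schedule n} → AllPairs Disjoint Δ → ∀ {u v} → Precedes Δ u v → rank Δ u < rank Δ v
  rank-increases {X ∷ Δ} (dis ∷ diss) {u} {v} u≺v with precedes-∷⁻ u≺v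
  ... | inj₁ (u∈X , v∈Δ)
    rewrite rank-∈ {Δ = Δ} u∈X | rank-∉ {Δ = Δ} (λ v∈X → disjoint⇒¬scheduled dis {v} v∈X v∈Δ) = z<s
  ... | inj₂ u≺v′
    rewrite rank-∉ {Δ = Δ} (λ u∈X → disjoint⇒¬scheduled dis {u} u∈X (precedes-source Δ u≺v′))
          | rank-∉ {Δ = Δ} (λ v∈X → disjoint⇒¬scheduled dis {v} v∈X (precedes-target Δ u≺v′)) =
    s<s (rank-increases diss u≺v′)

  -- Well-founded descent: as long as some element of `X` has smaller rank, move to it.
  minimal : ∀ (r : Fin n → ℕ) (X : Subset n) {s} → s ∈ X → Acc _<_ (r s) →
            ∃ λ m → m ∈ X × ∀ u → u ∈ X → ¬ r u < r m
  minimal r X {s} s∈X (acc rs) with Fin.any? (λ u → (u ∈? X) ×-dec (r u <? r s))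
  ... | yes (u , u∈X , ru<rs) = minimal r X u∈X (rs ru<rs)
  ... | no  ¬∃                = s , s∈X , λ u u∈X ru<rs → ¬∃ (u , u∈X , ru<rs)

module _ {q n : ℕ} (F : AN q (⊤ {n})) where

  unscheduled : ∀ Δ {v} → ¬ Scheduled Δ v → ∀ y → (F ⟨ Δ ⟩) y ! node v ≡ y ! node v
  unscheduled []          _   y = refl
  unscheduled (X ∷ Δ) {v} v∉Δ y = trans
    (unscheduled Δ (λ (j , v∈Y) → v∉Δ (Fin.suc j , v∈Y)) (updateBlock F X y))
    (updateBlock-∉ F X y (node v) λ v∈X → v∉Δ (Fin.zero , v∈X))

  -- The witness is the configuration to which the block of v is applied.
  beforeUpdate : ∀ {Δ} → AllPairs Disjoint Δ → ∀ {v} → Scheduled Δ v → ∀ y →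
    ∃ λ z → F z ! node v ≡ (F ⟨ Δ ⟩) y ! node v ×
      (∀ u → Precedes Δ u v → z ! node u ≡ (F ⟨ Δ ⟩) y ! node u) ×
      (∀ u → ¬ Precedes Δ u v → z ! node u ≡ y ! node u)
  beforeUpdate {X ∷ Δ} (dis ∷ diss) {v} v∈XΔ y with v ∈? X
  -- The block of `v` comes first, so it is applied to `y` itself, and no later block changes `v`.
  ... | yes v∈X = y ,
    sym (trans (unscheduled Δ v∉Δ (updateBlock F X y)) (updateBlock-∈ F X y (node v) v∈X)) ,
    (λ u u≺v → contradiction u≺v (¬precedes u)) ,
    (λ u _ → refl)
    where
    v∉Δ : ¬ Scheduled Δ v
    v∉Δ = disjoint⇒¬scheduled dis v∈X
    ¬precedes : ∀ u → ¬ Precedes (X ∷ Δ) u v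
    ¬precedes u u≺v with precedes-∷⁻ u≺v
    ... | inj₁ (_ , v∈Δ) = v∉Δ v∈Δ
    ... | inj₂ u≺v′      = v∉Δ (precedes-target Δ u≺v′)
  beforeUpdate {X ∷ Δ} (dis ∷ diss) {v} (Fin.zero , v∈X) y | no v∉X = contradiction v∈X v∉X
  beforeUpdate {X ∷ Δ} (dis ∷ diss) {v} (Fin.suc j , v∈Y) y | no v∉X
    with beforeUpdate diss (j , v∈Y) (updateBlock F X y)
  ... | z , Fz , before , after = z , Fz , before′ , after′
    where
    y′ = updateBlock F X y
    before′ : ∀ u → Precedes (X ∷ Δ) u v → z ! node u ≡ (F ⟨ Δ ⟩) y′ ! node u
    before′ u u≺v with precedes-∷⁻ u≺v
    ... | inj₂ u≺v′      = before u u≺v′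
    -- The head block has already updated `u` and no later block contains it, so `z` and the final
    -- configuration both agree with `y′` at `u`.
    ... | inj₁ (u∈X , _) = trans (after u (u∉Δ ∘ precedes-source Δ)) (sym (unscheduled Δ u∉Δ y′))
      where u∉Δ = disjoint⇒¬scheduled dis u∈X
    after′ : ∀ u → ¬ Precedes (X ∷ Δ) u v → z ! node u ≡ y ! node u
    after′ u u⊀v = trans (after u (u⊀v ∘ precedes-tail))
      (updateBlock-∉ F X y (node u) λ u∈X → u⊀v (precedes-head u∈X (j , v∈Y)))

-- Formulas

module _ {q : ℕ} {V : Set} where

  mutual
    eval-cong : ∀ {ρ ρ′ : V → Fin q} t → (∀ a → a occursIn t → ρ a ≡ ρ′ a) → eval ρ t ≡ eval ρ′ t
    eval-cong (var a)   eq = eq a in-var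
    eval-cong (op h ts) eq = cong h (evals-cong ts λ a o → eq a (in-op o))

    evals-cong : ∀ {ρ ρ′ : V → Fin q} {k} (ts : Vec (Formula q V) k) →
                 (∀ a → Any (a occursIn_) ts → ρ a ≡ ρ′ a) → evals ρ ts ≡ evals ρ′ ts
    evals-cong []       eq = refl
    evals-cong (t ∷ ts) eq = cong₂ _∷_ (eval-cong t λ a o → eq a (here o)) (evals-cong ts λ a o → eq a (there o))

  module _ {W : Set} (σ : V → Formula q W) where

    mutual
      eval-subst : ∀ (ρ : W → Fin q) t → eval ρ (subst σ t) ≡ eval (eval ρ ∘ σ) t
      eval-subst ρ (var a)   = refl
      eval-subst ρ (op h ts) = cong h (evals-substs ρ ts)

      evals-substs : ∀ (ρ : W → Fin q) {k} (ts : Vec (Formula q V) k) → evals ρ (substs σ ts) ≡ evals (eval ρ ∘ σ) ts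
      evals-substs ρ []       = refl
      evals-substs ρ (t ∷ ts) = cong₂ _∷_ (eval-subst ρ t) (evals-substs ρ ts)

    mutual
      occurs-subst : ∀ {b} t → b occursIn subst σ t → ∃ λ a → a occursIn t × b occursIn σ a
      occurs-subst (var a)   o         = a , in-var , o
      occurs-subst (op h ts) (in-op o) = let (a , o₁ , o₂) = occurs-substs ts o in a , in-op o₁ , o₂

      occurs-substs : ∀ {b k} (ts : Vec (Formula q V) k) → Any (b occursIn_) (substs σ ts) →
                      ∃ λ a → Any (a occursIn_) ts × b occursIn σ a
      occurs-substs (t ∷ ts) (here o)  = let (a , o₁ , o₂) = occurs-subst t o in a , here o₁ , o₂
      occurs-substs (t ∷ ts) (there o) = let (a , o₁ , o₂) = occurs-substs ts o in a , there o₁ , o₂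

-- Parallelization

symbols : ∀ {q n} → (x t : Config q (⊤ {n})) → Symbol n → Fin q
symbols x t (𝐱 i) = x ! node i
symbols x t (θ i) = t ! node i

ext-node : ∀ {q n} {x y : Config q (⊤ {n})} → (∀ i → x ! node i ≡ y ! node i) → x ≡ y
ext-node {x = x} {y} eq = ext λ (i , _) → trans (!-cong x refl) (trans (eq i) (!-cong y refl))

module _ {q n : ℕ} (F : AN q (⊤ {n})) (Δ : Schedule n) where

  -- The symbol θ u stands for the value of u after a whole step of F ⟨ Δ ⟩.
  record Parallelizing (X : Subset n) (f : Formulas q n) : Set where
    field
      pending : ∀ u v → θ u occursIn f v → u ∈ X × v ∈ X × Precedes Δ u v
      sound   : ∀ y v → eval (symbols y ((F ⟨ Δ ⟩) y)) (f v) ≡ (F ⟨ Δ ⟩) y ! node v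

  open Parallelizing

  delay-Parallelizing : BlockSequential ⊤ Δ → ∀ {f} → Represents f F → Parallelizing ⊤ (delay Δ f)
  delay-Parallelizing bs {f} rep = record { pending = pending₀ ; sound = sound₀ }
    where
    open BlockSequential bs

    occurs-delayed : ∀ {u v w} (d : Dec (Precedes Δ w v)) →
                     θ u occursIn var {q} (if does d then θ w else 𝐱 w) → Precedes Δ u v
    occurs-delayed (yes w≺v) in-var = w≺v

    pending₀ : ∀ u v → θ u occursIn delay Δ f v → u ∈ ⊤ × v ∈ ⊤ × Precedes Δ u v
    pending₀ u v o = let (w , _ , o′) = occurs-subst _ (f v) o in
      ∈⊤ , ∈⊤ , occurs-delayed (precedes? Δ w v) o′

    sound₀ : ∀ y v → eval (symbols y ((F ⟨ Δ ⟩) y)) (delay Δ f v) ≡ (F ⟨ Δ ⟩) y ! node v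
    sound₀ y v
      -- With 𝐱 read as the old values and θ as the new ones, the delayed formula reads exactly the
      -- configuration `z` to which the block of `v` is applied.
      with z , Fz , before , after ← beforeUpdate F disjoint {v}
             (covered⇒scheduled Δ (≡.subst (v ∈_) (sym covering) ∈⊤)) y = begin
      eval ρ (delay Δ f v)
        ≡⟨ eval-subst _ ρ (f v) ⟩
      eval (λ u → ρ (if does (precedes? Δ u v) then θ u else 𝐱 u)) (f v)
        ≡⟨ eval-cong (f v) (λ u _ → value u (precedes? Δ u v)) ⟩
      eval (λ u → z ! node u) (f v)
        ≡⟨ rep z v ⟩
      F z ! node v
        ≡⟨ Fz ⟩
      (F ⟨ Δ ⟩) y ! node v
        ∎
      where
      ρ = symbols y ((F ⟨ Δ ⟩) y)
      value : ∀ u (d : Dec (Precedes Δ u v)) → ρ (if does d then θ u else 𝐱 u) ≡ z ! node u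
      value u (yes u≺v) = sym (before u u≺v)
      value u (no  u⊀v) = sym (after u u⊀v)

  -- Soundness survives because θ `s` is read as the new value of `s`, which by soundness is also
  -- the value of `f s`. Since `f s` is free of θ symbols, the substitution eliminates θ `s` and
  -- introduces no other.
  resolve-Parallelizing : ∀ {X f s} → (∀ u → ¬ (θ u occursIn f s)) →
                          Parallelizing X f → Parallelizing (X - s) (resolve s (X - s) f)
  resolve-Parallelizing {X} {f} {s} θ-free inv = record
    { pending = λ u v → pending₁ u v (v ∈? (X - s))
    ; sound   = λ y v → sound₁ y v (v ∈? (X - s))
    }
    where
    occurs-resolved : ∀ {u} w (d : Dec (w ≡ s)) →
                      θ u occursIn (if does d then f s else var (θ w)) → u ≡ w × u ≢ s
    occurs-resolved w (yes _)   o      = contradiction o (θ-free _)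
    occurs-resolved w (no  w≢s) in-var = refl , w≢s

    pending₁ : ∀ u v (d : Dec (v ∈ X - s)) → θ u occursIn (if does d then subst [θ s ↦ f s ] (f v) else f v) →
               u ∈ X - s × v ∈ X - s × Precedes Δ u v
    pending₁ u v (yes v∈X-s) o with occurs-subst _ (f v) o
    ... | θ w , o₁ , o₂ with refl , w≢s ← occurs-resolved w (w Fin.≟ s) o₂ =
      let (u∈X , _ , u≺v) = pending inv w v o₁ in x∈p∧x≢y⇒x∈p-y u∈X w≢s , v∈X-s , u≺v
    -- By `pending`, `v` lies in `X`; outside `X - s` this leaves only `v = s`, whose formula
    -- contains no θ.
    pending₁ u v (no v∉X-s) o =
      contradiction (x∈p∧x≢y⇒x∈p-y (proj₁ (proj₂ (pending inv u v o))) λ { refl → θ-free u o }) v∉X-s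

    sound₁ : ∀ y v (d : Dec (v ∈ X - s)) →
             eval (symbols y ((F ⟨ Δ ⟩) y)) (if does d then subst [θ s ↦ f s ] (f v) else f v) ≡ (F ⟨ Δ ⟩) y ! node v
    sound₁ y v (no  _) = sound inv y v
    sound₁ y v (yes _) = begin
      eval ρ (subst [θ s ↦ f s ] (f v))     ≡⟨ eval-subst _ ρ (f v) ⟩
      eval (eval ρ ∘ [θ s ↦ f s ]) (f v)    ≡⟨ eval-cong (f v) (λ a _ → value a) ⟩
      eval ρ (f v)                          ≡⟨ sound inv y v ⟩
      (F ⟨ Δ ⟩) y ! node v                  ∎
      where
      ρ = symbols y ((F ⟨ Δ ⟩) y)
      value : ∀ a → eval ρ ([θ s ↦ f s ] a) ≡ ρ a
      value (𝐱 w) = refl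
      value (θ w) with w Fin.≟ s
      ... | yes refl = sound inv y s
      ... | no  _    = refl

  -- `Defines` holds for all values of the θ symbols, in particular for the final values of the
  -- automata, at which soundness is stated.
  Defines⇒≗ : ∀ {X f G} → Parallelizing X f → Defines f G → ∀ y → (F ⟨ Δ ⟩) y ≡ G y
  Defines⇒≗ {f = f} inv defines y = ext-node λ v → trans (sym (sound inv y v))
    (trans (eval-cong (f v) λ { (𝐱 _) _ → refl ; (θ _) _ → refl }) (defines y (λ i → (F ⟨ Δ ⟩) y ! node i) v))

  Defines-exists : ∀ {X f} → Empty X → Parallelizing X f → ∃ (Defines f)
  -- The second `y` in `symbols y y` is an arbitrary reading of the θ symbols: by `pending` none
  -- occurs once `X` is empty.
  Defines-exists {f = f} empty inv = (λ y → tabulate λ (i , _) → eval (symbols y y) (f i)) , λ y t v → trans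
    (eval-cong (f v) λ { (𝐱 _) _ → refl ; (θ u) o → contradiction (u , proj₁ (pending inv u v o)) empty })
    (sym (tabulate-! _ (node v)))

  -- A symbol θ `u` in the formula of an element of `X` of minimal rank would, by `pending`, put an
  -- element of smaller rank into `X`.
  θ-free-exists : AllPairs Disjoint Δ → ∀ {X f} → Nonempty X → Parallelizing X f →
                  ∃ λ s → s ∈ X × ∀ u → ¬ (θ u occursIn f s)
  θ-free-exists disjoint {X} (_ , s∈X) inv =
    let (m , m∈X , min) = minimal (rank Δ) X s∈X (<-wellFounded _) in
    m , m∈X , λ u o → let (u∈X , _ , u≺m) = pending inv u m o in min u u∈X (rank-increases disjoint u≺m)

-- Runs of the algorithm

-- Accessibility for `flip _⟶_` excludes infinite runs. The phases are treated from last to first,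
-- with measures `∣ S ∣` for pruning, the list of untreated pairs for merging and `∣ X ∣` for
-- parallelizing.
returned-acc : ∀ {q n S} {F : AN q {n} S} → Acc (flip _⟶_) (returned S F)
returned-acc = acc λ ()

pruning-acc : ∀ {q n} S {F : AN q {n} S} → Acc _<_ ∣ S ∣ → Acc (flip _⟶_) (pruning S F)
pruning-acc S (acc rs) = acc λ
  { (remove u _ _) → pruning-acc (S - proj₁ u) (rs (x∈p⇒∣p-x∣<∣p∣ (proj₂ u)))
  ; (return _)     → returned-acc
  }

merging-acc : ∀ {q n} ps {F : AN q (⊤ {n})} → Acc (flip _⟶_) (merging ps F)
merging-acc []       = acc λ { all-treated → pruning-acc ⊤ (<-wellFounded _) }
merging-acc (p ∷ ps) = acc λ { (merge _ _ _) → merging-acc ps ; (no-merge _) → merging-acc ps }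

parallelizing-acc : ∀ {q n} X {f : Formulas q n} → Acc _<_ ∣ X ∣ → Acc (flip _⟶_) (parallelizing X f)
parallelizing-acc X (acc rs) = acc λ
  { (resolving {s = s} s∈X _)  → parallelizing-acc (X - s) (rs (x∈p⇒∣p-x∣<∣p∣ s∈X))
  ; (parallel {ps = ps} _ _ _) → merging-acc ps
  }

module _ {q n : ℕ} (a : Fin q) (F : AN q (⊤ {n})) (Δ : Schedule n) where

  -- While formulas still contain θ symbols there is no network to compare with, so the first phase
  -- carries the invariant on formulas; from the first network on, it is the isomorphism itself.
  Invariant : State q n → Set
  Invariant (parallelizing X f) = Parallelizing F Δ X f
  Invariant (merging _ G)       = limitDynamics (F ⟨ Δ ⟩) ≅ limitDynamics G
  Invariant (pruning _ G)       = limitDynamics (F ⟨ Δ ⟩) ≅ limitDynamics G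
  Invariant (returned _ G)      = limitDynamics (F ⟨ Δ ⟩) ≅ limitDynamics G

  preserved : ∀ {σ τ} → σ ⟶ τ → Invariant σ → Invariant τ
  preserved (resolving _ θ-free)       inv = resolve-Parallelizing F Δ θ-free inv
  preserved (parallel _ defines _)     inv = limitDynamics-cong (Defines⇒≗ F Δ inv defines)
  preserved (merge g factors merged)   inv = ≅-trans inv (Merge-limitDynamics factors merged)
  preserved (no-merge _)               inv = inv
  preserved all-treated                inv = inv
  preserved (remove u sink removal)    inv = ≅-trans inv (Removal-limitDynamics a u sink removal)
  preserved (return _)                 inv = inv

  preserved⋆ : ∀ {σ τ} → Star _⟶_ σ τ → Invariant σ → Invariant τ
  preserved⋆ ε        inv = inv
  preserved⋆ (r ◅ rs) inv = preserved⋆ rs (preserved r inv)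

  progress : AllPairs Disjoint Δ → ∀ σ → Invariant σ → Returned σ ⊎ ∃ λ τ → σ ⟶ τ
  progress disjoint (parallelizing X f) inv with nonempty? X
  ... | yes nonempty = let (s , s∈X , θ-free) = θ-free-exists F Δ disjoint nonempty inv in
    inj₂ (_ , resolving s∈X θ-free)
  ... | no  empty    = let (G , defines) = Defines-exists F Δ empty inv in
    -- Any order of the pairs would do; the run is continued with the order of the product list.
    inj₂ (_ , parallel {F = G} empty defines ↭-refl)
  progress _ (merging [] G) _ = inj₂ (_ , all-treated)
  progress _ (merging ((u , v) ∷ ps) G) _ with factors? G (node u) (node v)
  ... | yes (g , factors) = inj₂ (_ , merge g factors redirect-Merge)
  ... | no  ¬factors      = inj₂ (_ , no-merge ¬factors)
  progress _ (pruning S G) _ with sink? G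
  ... | yes (u , sink) = let (G′ , removal) = Removal-exists {F = G} a u sink in
    inj₂ (_ , remove u {G′} sink removal)
  ... | no  ¬sink      = inj₂ (_ , return ¬sink)
  progress _ (returned S G) _ = inj₁ (returned S G)

letter : ∀ q .{{_ : NonZero q}} → Fin q
letter (suc q) = Fin.zero

theorem2 : ∀ (q n : ℕ) .{{_ : NonZero q}} (F : AN q (⊤ {n})) (Δ : Schedule n) → BlockSequential ⊤ Δ →
    -- for every presentation of the local functions of F by formulas,
    ∀ (f : Fin n → Formula q (Fin n)) → Represents f F →
    -- every run of the algorithm is finite,
    Acc (flip _⟶_) (start Δ f) ×
    -- can be continued until a network is returned,
    (∀ σ → Star _⟶_ (start Δ f) σ → Returned σ ⊎ ∃ λ τ → σ ⟶ τ) ×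
    -- and returns only networks with the required limit dynamics
    (∀ S F′ → Star _⟶_ (start Δ f) (returned S F′) → limitDynamics (F ⟨ Δ ⟩) ≅ limitDynamics (F′ ⟨ π S ⟩))
theorem2 q n F Δ bs f rep =
  parallelizing-acc ⊤ (<-wellFounded _) ,
  (λ σ run → progress (letter q) F Δ disjoint σ (invariant run)) ,
  (λ S F′ run → ≅-trans (invariant run) (limitDynamics-cong (parallel-update F′)))
  where
  open BlockSequential bs using (disjoint)
  invariant : ∀ {σ} → Star _⟶_ (start Δ f) σ → Invariant (letter q) F Δ σ
  invariant run = preserved⋆ (letter q) F Δ run (delay-Parallelizing F Δ bs {f} rep)
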